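{- Let $S$ be a numerical semigroup with embedding dimension $\mathrm{e}(S)=2$, so $S=\langle a,b\rangle$ for integers $a,b>1$ with $\gcd(a,b)=1$, and let $m$ be a positive integer. Then $\mathrm{H}(S)$ is equidistributed modulo $m$ if and only if $\gcd(ab,m)=1$ and at least one of the following holds: (1) $a\equiv1\pmod m$; or (2) $b\equiv1\pmod m$.
   Context: A numerical semigroup is a submonoid $S$ of $(\mathbb{N}_0,+)$ with finite complement; $\mathrm{H}(S)=\mathbb{N}_0\setminus S$ is its set of gaps. $\langle a,b\rangle$ is the set of all $\mathbb{N}_0$-linear combinations of $a$ and $b$. The embedding dimension $\mathrm{e}(S)$ is the cardinality of the unique minimal generating set of $S$. A finite (multi)set of integers is equidistributed modulo $m$ if it contains the same number of elements in each congruence class modulo $m$. -}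

module Defs where

open import Data.List.Base using (List; length; filter)
open import Data.List.Membership.Propositional using (_∈_)
open import Data.List.Relation.Binary.Subset.Propositional using (_⊆_)
open import Data.List.Relation.Unary.Unique.Propositional using (Unique)
open import Data.Nat.Base using (ℕ; _+_; _*_; _%_; NonZero)
open import Data.Nat.Properties using (_≟_)
open import Data.Product.Base using (_×_; ∃-syntax)
open import Data.Vec.Base using (fromList; sum; zipWith)
open import Function.Bundles using (_⇔_)
open import Level using (0ℓ)
open import Relation.Binary.PropositionalEquality.Core using (_≡_)
open import Relation.Nullary.Decidable.Core using (Dec)
open import Relation.Unary using (Pred; ∁; _≐_)

-- Finiteness is an explicit duplicate-free enumeration, so that the elements
-- can be counted.
record Finite (P : Pred ℕ 0ℓ) : Set where
  field
    elements : List ℕ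
    unique   : Unique elements
    complete : ∀ n → n ∈ elements ⇔ P n

record NumericalSemigroup : Set₁ where
  field
    Carrier   : Pred ℕ 0ℓ
    0-closed  : Carrier 0
    +-closed  : ∀ {x y} → Carrier x → Carrier y → Carrier (x + y)
    cofinite  : Finite (∁ Carrier)

open NumericalSemigroup public using (Carrier)

H : NumericalSemigroup → List ℕ
H S = Finite.elements (NumericalSemigroup.cofinite S)

⟨_⟩ : List ℕ → Pred ℕ 0ℓ
⟨ gs ⟩ n = ∃[ cs ] n ≡ sum {length gs} (zipWith _*_ cs (fromList gs))

-- The list gs stands for its set of members; minimality is with respect to
-- inclusion of these sets.
IsMinimalGeneratingSet : NumericalSemigroup → List ℕ → Set
IsMinimalGeneratingSet S gs =
  Carrier S ≐ ⟨ gs ⟩ × (∀ hs → hs ⊆ gs → Carrier S ≐ ⟨ hs ⟩ → gs ⊆ hs)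

-- "e(S) = k", as a relation: uniqueness of the minimal generating set makes k
-- unique, and Unique makes the length of the list the cardinality of the set.
HasEmbeddingDimension : NumericalSemigroup → ℕ → Set
HasEmbeddingDimension S k =
  ∃[ gs ] Unique gs × IsMinimalGeneratingSet S gs × length gs ≡ k

infix 4 _≡_[mod_] _≡?_[mod_]

_≡_[mod_] : ℕ → ℕ → (m : ℕ) → .{{NonZero m}} → Set
x ≡ y [mod m ] = x % m ≡ y % m

_≡?_[mod_] : ∀ x y m .{{_ : NonZero m}} → Dec (x ≡ y [mod m ])
x ≡? y [mod m ] = x % m ≟ y % m

-- A list is read as a finite multiset; r and s are arbitrary representatives
-- of congruence classes.
EquidistributedModulo : (m : ℕ) → .{{NonZero m}} → List ℕ → Set
EquidistributedModulo m xs = ∀ r s → classSize r ≡ classSize s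
  where
  classSize : ℕ → ℕ
  classSize r = length (filter (λ x → x ≡? r [mod m ]) xs)

{-# OPTIONS --safe #-}

-- Let Ap = {a i : i < b}, the Apéry set of S = ⟨a, b⟩ with respect to b.  A
-- number n lies in H ∪ Ap iff n < b or n − b ∈ H, so that, as multisets,
-- H + Ap = (b + H) + {0, …, b − 1}.
--
-- If a ≡ 1 (mod m), then Ap and {0, …, b − 1} have the same residues, so the
-- class sizes of H are periodic with period b as well as m, hence constant.
--
-- Conversely, if H is equidistributed, then Ap and I = {0, …, b − 1} have the
-- same residues modulo m.  Comparing the class of 1 shows that a is a unit, and
-- by symmetry so is b.  Let a′, b′ be the residues of a, b.  If b′ ≥ 2, then the
-- multiplicity in I of r < m is largest exactly when r < b′.  The classes of a
-- in Ap and of 1 in I are equally large, so a′ < b′.  Now Ap and a + Ap differ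
-- only by the elements 0 and ab, while the class of b′ − a′ in Ap is larger than
-- that of b′; hence b ≡ ab, i.e. a ≡ 1.
module Submission where

open import Defs
open import Data.Empty using (⊥-elim)
open import Data.List.Base
  using (List; []; _∷_; [_]; _++_; _∷ʳ_; map; length; filter; applyUpTo; upTo)
open import Data.List.Extrema.Nat using (max; xs≤max)
open import Data.List.Membership.DecPropositional using (_∈?_)
open import Data.List.Membership.Propositional using (_∈_; _∉_; lose)
open import Data.List.Membership.Propositional.Properties
  using (∈-++⁺ˡ; ∈-++⁺ʳ; ∈-++⁻; ∈-map⁺; ∈-map⁻; ∈-applyUpTo⁺; ∈-applyUpTo⁻;
         ∈-upTo⁺; ∈-upTo⁻; ∈-filter⁻)
open import Data.List.Membership.Propositional.Properties.WithK
  using (unique∧set⇒bag)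
open import Data.List.Properties
  using (filter-++; length-++; filter-accept; filter-reject; filter-some;
         applyUpTo-∷ʳ)
open import Data.List.Relation.Binary.BagAndSetEquality using (∼bag⇒↭)
open import Data.List.Relation.Binary.Permutation.Propositional using (_↭_)
open import Data.List.Relation.Binary.Permutation.Propositional.Properties
  using (filter-↭; ↭-length)
open import Data.List.Relation.Binary.Pointwise as Pointwise
  using (Pointwise; []; _∷_; Pointwise-length)
open import Data.List.Relation.Unary.All as All using ([]; _∷_)
open import Data.List.Relation.Unary.Any using (here; there)
import Data.List.Relation.Unary.AllPairs as AllPairs
import Data.List.Relation.Unary.Unique.Propositional.Properties as Unique
open import Data.Nat.Base
open import Data.Nat.Coprimality as Coprime
  using (Coprime; coprime-divisor; coprime-Bézout; gcd≡1⇒coprime; coprime⇒gcd≡1)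
open import Data.Nat.Divisibility
open import Data.Nat.DivMod
open import Data.Nat.GCD
open import Data.Nat.Properties
open import Data.Nat.Tactic.RingSolver using (solve-∀)
open import Data.Product.Base using (_×_; _,_; proj₁; proj₂; ∃-syntax)
open import Data.Sum.Base as Sum using (_⊎_; inj₁; inj₂)
open import Data.Vec.Base using ([]; _∷_)
open import Function.Base using (_∘_; id; case_of_)
open import Function.Bundles using (_⇔_; mk⇔; Equivalence)
open import Relation.Binary.Definitions using (tri<; tri≈; tri>)
open import Relation.Binary.PropositionalEquality hiding ([_])
open import Relation.Nullary using (¬_; yes; no; contradiction)
open import Relation.Nullary.Decidable using (decidable-stable)
open import Relation.Unary using (_≐_)

open Equivalence using (to; from)

-- Numerical semigroups on two generators.

combine : ∀ {a b n} x y → n ≡ x * a + y * b → ⟨ a ∷ b ∷ [] ⟩ n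
combine {a} {b} x y n≡ =
  x ∷ y ∷ [] , trans n≡ (cong (x * a +_) (sym (+-identityʳ (y * b))))

coefficients : ∀ {a b n} → ⟨ a ∷ b ∷ [] ⟩ n → ∃[ x ] ∃[ y ] n ≡ x * a + y * b
coefficients {a} {b} (x ∷ y ∷ [] , n≡) =
  x , y , trans n≡ (cong (x * a +_) (+-identityʳ (y * b)))

⟨⟩-swap : ∀ {a b n} → ⟨ a ∷ b ∷ [] ⟩ n → ⟨ b ∷ a ∷ [] ⟩ n
⟨⟩-swap {a} {b} n∈ with x , y , n≡ ← coefficients n∈ =
  combine y x (trans n≡ (+-comm (x * a) (y * b)))

≐⟨⟩-swap : ∀ S {a b} → Carrier S ≐ ⟨ a ∷ b ∷ [] ⟩ → Carrier S ≐ ⟨ b ∷ a ∷ [] ⟩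
≐⟨⟩-swap S (S⊆ , ⊆S) = (λ s → ⟨⟩-swap (S⊆ s)) , (λ s → ⊆S (⟨⟩-swap s))

-- `Carrier S` is an arbitrary predicate and only its complement is enumerated, so membership comes
-- out doubly negated. The uses aim at decidable goals, where this is enough.
non-gap⇒¬¬∈ : ∀ S {n} → n ∉ H S → ¬ ¬ Carrier S n
non-gap⇒¬¬∈ S {n} n∉H ¬Sn =
  n∉H (from (Finite.complete (NumericalSemigroup.cofinite S) n) ¬Sn)

gap⇒∉ : ∀ S {n} → n ∈ H S → ¬ Carrier S n
gap⇒∉ S {n} = to (Finite.complete (NumericalSemigroup.cofinite S) n)

-- Two consecutive numbers beyond the largest gap are both divisible by d.
common-divisor≡1 : ∀ S d → (∀ {n} → Carrier S n → d ∣ n) → d ≡ 1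
common-divisor≡1 S d d∣S = ∣1⇒≡1 (∣m+n∣m⇒∣n d∣N+1 (d∣large ≤-refl))
  where
  N = suc (max 0 (H S))

  d∣large : ∀ {n} → N ≤ n → d ∣ n
  d∣large {n} N≤n = decidable-stable (d ∣? n) λ d∤n →
    non-gap⇒¬¬∈ S (λ n∈H → <⇒≱ N≤n (All.lookup (xs≤max 0 (H S)) n∈H))
      (d∤n ∘ d∣S)

  d∣N+1 : d ∣ N + 1
  d∣N+1 = d∣large (m≤m+n N 1)

-- A generator 0 contributes nothing, so the other one suffices; a generator 1 already yields every
-- number. Either way a single generator would do, which minimality excludes.
generator>1 : ∀ S {a b} → Carrier S ≐ ⟨ a ∷ b ∷ [] ⟩ →
  ¬ Carrier S ≐ ⟨ a ∷ [] ⟩ → ¬ Carrier S ≐ ⟨ b ∷ [] ⟩ → 1 < a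
generator>1 S {0} {b} (S⊆ , ⊆S) _ ¬b = ⊥-elim (¬b (⊆⟨b⟩ , ⟨b⟩⊆))
  where
  ⊆⟨b⟩ : ∀ {n} → Carrier S n → ⟨ b ∷ [] ⟩ n
  ⊆⟨b⟩ s with x ∷ y ∷ [] , n≡ ← S⊆ s =
    y ∷ [] , trans n≡ (cong (_+ (y * b + 0)) (*-zeroʳ x))

  ⟨b⟩⊆ : ∀ {n} → ⟨ b ∷ [] ⟩ n → Carrier S n
  ⟨b⟩⊆ (y ∷ [] , n≡) = ⊆S (0 ∷ y ∷ [] , n≡)
generator>1 S {1} {b} (_ , ⊆S) ¬a _ = ⊥-elim (¬a (⊆⟨1⟩ , ⟨1⟩⊆))
  where
  n≡n*1+0 : ∀ n → n ≡ n * 1 + 0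
  n≡n*1+0 n = sym (trans (+-identityʳ (n * 1)) (*-identityʳ n))

  ⊆⟨1⟩ : ∀ {n} → Carrier S n → ⟨ 1 ∷ [] ⟩ n
  ⊆⟨1⟩ {n} _ = n ∷ [] , n≡n*1+0 n

  ⟨1⟩⊆ : ∀ {n} → ⟨ 1 ∷ [] ⟩ n → Carrier S n
  ⟨1⟩⊆ {n} _ = ⊆S (combine n 0 (n≡n*1+0 n))
generator>1 S {suc (suc _)} _ _ _ = s≤s (s≤s z≤n)

coprime-generators : ∀ S → HasEmbeddingDimension S 2 →
  ∃[ a ] ∃[ b ] (1 < a × 1 < b × gcd a b ≡ 1 × Carrier S ≐ ⟨ a ∷ b ∷ [] ⟩)
coprime-generators S
  (a ∷ b ∷ [] , ((a≢b ∷ []) AllPairs.∷ _) , (S≐@(S⊆ , _) , minimal) , refl) =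
  a , b , generator>1 S S≐ ¬⟨a⟩ ¬⟨b⟩ , generator>1 S (≐⟨⟩-swap S S≐) ¬⟨b⟩ ¬⟨a⟩ ,
  common-divisor≡1 S (gcd a b) gcd∣S , S≐
  where
  -- Minimality applied to a one-element sublist puts the other generator in it, against `a≢b`.
  ¬⟨a⟩ : ¬ Carrier S ≐ ⟨ a ∷ [] ⟩
  ¬⟨a⟩ S≐⟨a⟩ with minimal [ a ] (λ { (here refl) → here refl }) S≐⟨a⟩ (there (here refl))
  ... | here b≡a = a≢b (sym b≡a)

  ¬⟨b⟩ : ¬ Carrier S ≐ ⟨ b ∷ [] ⟩
  ¬⟨b⟩ S≐⟨b⟩ with minimal [ b ] (λ { (here refl) → there (here refl) }) S≐⟨b⟩ (here refl)
  ... | here a≡b = a≢b a≡b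

  gcd∣S : ∀ {n} → Carrier S n → gcd a b ∣ n
  gcd∣S s with x , y , refl ← coefficients (S⊆ s) =
    ∣m∣n⇒∣m+n (∣n⇒∣m*n x (gcd[m,n]∣m a b)) (∣n⇒∣m*n y (gcd[m,n]∣n a b))

-- Gaps and the Apéry set.

module _ (S : NumericalSemigroup) {a b : ℕ} (1<a : 1 < a) (1<b : 1 < b)
         (a⊥b : Coprime a b) (S≐ : Carrier S ≐ ⟨ a ∷ b ∷ [] ⟩) where

  private
    instance
      a-nonZero : NonZero a
      a-nonZero = >-nonZero (<-trans z<s 1<a)

    Ap = applyUpTo (a *_) b

    ∈S : ∀ {n} x y → n ≡ x * a + y * b → Carrier S n
    ∈S x y n≡ = proj₂ S≐ (combine x y n≡)

    S⇒ : ∀ {n} → Carrier S n → ∃[ x ] ∃[ y ] n ≡ x * a + y * b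
    S⇒ s = coefficients (proj₁ S≐ s)

  -- If `n` were `x * a + y * b`, then `a * (i ∸ x)` would be `suc y * b`; being coprime to `a`, `b`
  -- would divide `i ∸ x`, which is positive and below `b`.
  Apéry-minimal : ∀ {i n} → i < b → a * i ≡ b + n → ¬ Carrier S n
  Apéry-minimal {i} i<b ai≡ s with x , y , refl ← S⇒ s =
    >⇒∤ {{>-nonZero (m<n⇒0<n∸m x<i)}} (≤-<-trans (m∸n≤m i x) i<b)
      (coprime-divisor (Coprime.sym a⊥b) (divides (suc y) a[i∸x]≡))
    where
    ai≡′ : a * i ≡ a * x + suc y * b
    ai≡′ = trans ai≡ (lemma a b x y)
      where
      lemma : ∀ a b x y → b + (x * a + y * b) ≡ a * x + suc y * b
      lemma = solve-∀

    x<i : x < i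
    x<i = *-cancelˡ-< a x i (subst (a * x <_) (sym ai≡′)
      (m<m+n (a * x) (<-≤-trans (<-trans z<s 1<b) (m≤m+n b (y * b)))))

    a[i∸x]≡ : a * (i ∸ x) ≡ suc y * b
    a[i∸x]≡ = trans (*-distribˡ-∸ a i x)
      (trans (cong (_∸ a * x) ai≡′) (m+n∸m≡n (a * x) (suc y * b)))

  -- Membership in a list of numbers is decidable, so the doubly negated membership in `S` can be
  -- discharged here.
  gap-or-Apéry : ∀ {n} → (Carrier S n → n ∈ Ap) → n ∈ H S ++ Ap
  gap-or-Apéry {n} S⇒Ap = decidable-stable (_∈?_ _≟_ n (H S ++ Ap)) λ n∉ →
    non-gap⇒¬¬∈ S (n∉ ∘ ∈-++⁺ˡ) (n∉ ∘ ∈-++⁺ʳ (H S) ∘ S⇒Ap)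

  -- Both lists are duplicate-free, so equality as sets already makes them permutations of each
  -- other, and residue counts can be compared.
  gaps++Apéry↭ : H S ++ Ap ↭ map (b +_) (H S) ++ upTo b
  gaps++Apéry↭ =
    ∼bag⇒↭ (unique∧set⇒bag uniqueˡ uniqueʳ (mk⇔ ⇒ ⇐))
    where
    uniqueH = Finite.unique (NumericalSemigroup.cofinite S)

    uniqueˡ = Unique.++⁺ uniqueH
      (Unique.applyUpTo⁺₁ (a *_) b (λ i<j _ ai≡aj → <⇒≢ i<j (*-cancelˡ-≡ _ _ a ai≡aj)))
      λ (n∈H , n∈Ap) → case ∈-applyUpTo⁻ (a *_) n∈Ap of λ
        { (i , _ , refl) → gap⇒∉ S n∈H
            (∈S i 0 (trans (*-comm a i) (sym (+-identityʳ (i * a))))) }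

    uniqueʳ = Unique.++⁺ (Unique.map⁺ (+-cancelˡ-≡ b _ _) uniqueH) (Unique.upTo⁺ b)
      λ (n∈b+H , n<b) → case ∈-map⁻ (b +_) n∈b+H of λ
        { (h , _ , refl) → <⇒≱ (∈-upTo⁻ n<b) (m≤m+n b h) }

    right : ∀ n → (∀ h → n ≡ b + h → ¬ Carrier S h) → n ∈ map (b +_) (H S) ++ upTo b
    right n gap with n <? b
    ... | yes n<b = ∈-++⁺ʳ (map (b +_) (H S)) (∈-upTo⁺ n<b)
    ... | no n≮b = ∈-++⁺ˡ (subst (_∈ map (b +_) (H S)) (sym n≡) (∈-map⁺ (b +_)
        (from (Finite.complete (NumericalSemigroup.cofinite S) (n ∸ b)) (gap (n ∸ b) n≡))))
      where
      n≡ : n ≡ b + (n ∸ b)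
      n≡ = sym (m+[n∸m]≡n (≮⇒≥ n≮b))

    ⇒ : ∀ {n} → n ∈ H S ++ Ap → n ∈ map (b +_) (H S) ++ upTo b
    ⇒ {n} n∈ = right n (case ∈-++⁻ (H S) n∈ of λ
      { (inj₁ n∈H) h refl Sh → gap⇒∉ S n∈H
          (NumericalSemigroup.+-closed S (∈S 0 1 (sym (+-identityʳ b))) Sh)
      ; (inj₂ n∈Ap) h n≡ → case ∈-applyUpTo⁻ (a *_) n∈Ap of λ
          { (i , i<b , refl) → Apéry-minimal i<b n≡ } })

    xa∈Ap : ∀ {n} x → n ≡ x * a + 0 → x < b → n ∈ Ap
    xa∈Ap x n≡ x<b =
      subst (_∈ Ap) (sym (trans n≡ (trans (+-identityʳ (x * a)) (*-comm x a))))
        (∈-applyUpTo⁺ (a *_) x<b)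

    -- Below `b` the coefficient of `b` must vanish, and then `x ≤ x * a < b` because `a` is
    -- nonzero.
    small : ∀ {n} → n < b → Carrier S n → n ∈ Ap
    small n<b s with S⇒ s
    ... | x , zero , n≡ = xa∈Ap x n≡ (≤-<-trans x≤n n<b)
      where
      x≤n : x ≤ _
      x≤n = subst (x ≤_) (sym (trans n≡ (+-identityʳ (x * a)))) (m≤m*n x a)
    ... | x , suc y , refl =
      contradiction (≤-trans (m≤m+n b (y * b)) (m≤n+m (suc y * b) (x * a))) (<⇒≱ n<b)

    -- A positive coefficient of `b` could be lowered by one, which would put the gap `h` in `S`.
    shifted : ∀ {h} → h ∈ H S → Carrier S (b + h) → b + h ∈ Ap
    shifted {h} h∈H s with S⇒ s
    ... | x , suc y , b+h≡ = contradiction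
        (∈S x y (+-cancelˡ-≡ b _ _ (trans b+h≡ (lemma a b x y)))) (gap⇒∉ S h∈H)
      where
      lemma : ∀ a b x y → x * a + suc y * b ≡ b + (x * a + y * b)
      lemma = solve-∀
    ... | x , zero , b+h≡ with x <? b
    ... | yes x<b = xa∈Ap x b+h≡ x<b
    -- Trade `b` copies of `a` for `a` copies of `b`; one of these cancels the shift, leaving
    -- `pred a`.
    ... | no x≮b = contradiction (∈S (x ∸ b) (pred a) (+-cancelˡ-≡ b _ _ b+h≡′)) (gap⇒∉ S h∈H)
      where
      lemma : ∀ a′ b z → (b + z) * suc a′ + 0 ≡ b + (z * suc a′ + a′ * b)
      lemma = solve-∀

      b+h≡′ : b + h ≡ b + ((x ∸ b) * a + pred a * b)
      b+h≡′ = trans b+h≡ (subst₂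
        (λ x′ a → x′ * a + 0 ≡ b + ((x ∸ b) * a + pred a * b))
        (m+[n∸m]≡n (≮⇒≥ x≮b)) (suc-pred a) (lemma (pred a) b (x ∸ b)))

    ⇐ : ∀ {n} → n ∈ map (b +_) (H S) ++ upTo b → n ∈ H S ++ Ap
    ⇐ n∈ with ∈-++⁻ (map (b +_) (H S)) n∈
    ... | inj₂ n<b = gap-or-Apéry (small (∈-upTo⁻ n<b))
    ... | inj₁ n∈b+H with h , h∈H , refl ← ∈-map⁻ (b +_) n∈b+H =
      gap-or-Apéry (shifted h∈H)

-- Functions with two coprime periods.

periodic-* : ∀ {f : ℕ → ℕ} {p} → (∀ r → f (p + r) ≡ f r) → ∀ k r → f (k * p + r) ≡ f r
periodic-* f-p zero r = refl
periodic-* {f} {p} f-p (suc k) r =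
  trans (cong f (+-assoc p (k * p) r)) (trans (f-p (k * p + r)) (periodic-* f-p k r))

-- By Bézout a multiple of one period exceeds a multiple of the other by 1, so 1 is itself a period.
-- Either period may supply the larger multiple, whence two cases.
coprime-periods⇒constant : ∀ {f : ℕ → ℕ} {p q} → Coprime p q →
  (∀ r → f (p + r) ≡ f r) → (∀ r → f (q + r) ≡ f r) → ∀ r s → f r ≡ f s
coprime-periods⇒constant {f} p⊥q f-p f-q r s = trans (const r) (sym (const s))
  where
  period-1 : ∀ {p q x y} → 1 + y * q ≡ x * p →
    (∀ r → f (p + r) ≡ f r) → (∀ r → f (q + r) ≡ f r) → ∀ r → f (suc r) ≡ f r
  period-1 {p} {q} {x} {y} eq f-p f-q r = begin
    f (suc r)           ≡⟨ periodic-* f-q y (suc r) ⟨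
    f (y * q + suc r)   ≡⟨ cong f (trans (+-suc (y * q) r) (cong (_+ r) eq)) ⟩
    f (x * p + r)       ≡⟨ periodic-* f-p x r ⟩
    f r                 ∎
    where open ≡-Reasoning

  step : ∀ r → f (suc r) ≡ f r
  step with coprime-Bézout p⊥q
  ... | Bézout.Identity.+- x y eq = period-1 {x = x} {y} eq f-p f-q
  ... | Bézout.Identity.-+ x y eq = period-1 {x = y} {x} eq f-q f-p

  const : ∀ r → f r ≡ f 0
  const zero = refl
  const (suc r) = trans (step r) (const r)

-- Congruences modulo `m`.

module _ {m : ℕ} .{{_ : NonZero m}} where

  -- The distance needs no ordering of `x` and `y`, is unchanged by translation and scales with
  -- factors, so cancelling in a congruence becomes a question of divisors.
  ≡mod⇒∣ : ∀ {x y} → x ≡ y [mod m ] → m ∣ ∣ x - y ∣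
  ≡mod⇒∣ {x} {y} x≡y = divides ∣ x / m - y / m ∣ (begin
    ∣ x - y ∣
      ≡⟨ cong₂ ∣_-_∣ (m≡m%n+[m/n]*n x m)
           (trans (m≡m%n+[m/n]*n y m) (cong (_+ y / m * m) (sym x≡y))) ⟩
    ∣ x % m + x / m * m - x % m + y / m * m ∣
      ≡⟨ ∣m+n-m+o∣≡∣n-o∣ (x % m) _ _ ⟩
    ∣ x / m * m - y / m * m ∣
      ≡⟨ *-distribʳ-∣-∣ m (x / m) (y / m) ⟨
    ∣ x / m - y / m ∣ * m ∎)
    where open ≡-Reasoning

  ∣⇒≡mod : ∀ {x y} → m ∣ ∣ x - y ∣ → x ≡ y [mod m ]
  ∣⇒≡mod {x} {y} m∣ with ≤-total x y
  ... | inj₁ x≤y = begin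
    x % m             ≡⟨ %-remove-+ʳ x (subst (m ∣_) (m≤n⇒∣m-n∣≡n∸m x≤y) m∣) ⟨
    (x + (y ∸ x)) % m ≡⟨ cong (_% m) (m+[n∸m]≡n x≤y) ⟩
    y % m             ∎
    where open ≡-Reasoning
  ... | inj₂ y≤x = begin
    x % m             ≡⟨ cong (_% m) (m+[n∸m]≡n y≤x) ⟨
    (y + (x ∸ y)) % m ≡⟨ %-remove-+ʳ y (subst (m ∣_) (m≤n⇒∣n-m∣≡n∸m y≤x) m∣) ⟩
    y % m             ∎
    where open ≡-Reasoning

  +-congˡ-mod : ∀ k {x y} → x ≡ y [mod m ] → k + x ≡ k + y [mod m ]
  +-congˡ-mod k {x} {y} x≡y =
    ∣⇒≡mod (subst (m ∣_) (sym (∣m+n-m+o∣≡∣n-o∣ k x y)) (≡mod⇒∣ x≡y))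

  +-cancelˡ-mod : ∀ k {x y} → k + x ≡ k + y [mod m ] → x ≡ y [mod m ]
  +-cancelˡ-mod k {x} {y} eq =
    ∣⇒≡mod (subst (m ∣_) (∣m+n-m+o∣≡∣n-o∣ k x y) (≡mod⇒∣ eq))

  *-congˡ-mod : ∀ k {x y} → x ≡ y [mod m ] → k * x ≡ k * y [mod m ]
  *-congˡ-mod k {x} {y} x≡y =
    ∣⇒≡mod (subst (m ∣_) (*-distribˡ-∣-∣ k x y) (∣n⇒∣m*n k (≡mod⇒∣ x≡y)))

  *-cancelˡ-mod : ∀ {k} → Coprime m k → ∀ {x y} → k * x ≡ k * y [mod m ] → x ≡ y [mod m ]
  *-cancelˡ-mod {k} m⊥k {x} {y} eq =
    ∣⇒≡mod (coprime-divisor m⊥k (subst (m ∣_) (sym (*-distribˡ-∣-∣ k x y)) (≡mod⇒∣ eq)))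

  %-mod : ∀ x → x % m ≡ x [mod m ]
  %-mod x = m%n%n≡m%n x m

  -- Counting a residue class in a list.

  count : List ℕ → ℕ → ℕ
  count xs r = length (filter (λ x → x ≡? r [mod m ]) xs)

  count-++ : ∀ xs ys r → count (xs ++ ys) r ≡ count xs r + count ys r
  count-++ xs ys r =
    trans (cong length (filter-++ (λ x → x ≡? r [mod m ]) xs ys)) (length-++ (filter _ xs))

  count-↭ : ∀ {xs ys} → xs ↭ ys → ∀ r → count xs r ≡ count ys r
  count-↭ xs↭ys r = ↭-length (filter-↭ (λ x → x ≡? r [mod m ]) xs↭ys)

  count-[≡] : ∀ {x r} → x ≡ r [mod m ] → count [ x ] r ≡ 1
  count-[≡] {x} {r} x≡r = cong length (filter-accept (λ x → x ≡? r [mod m ]) x≡r)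

  count-[≢] : ∀ {x r} → ¬ x ≡ r [mod m ] → count [ x ] r ≡ 0
  count-[≢] {x} {r} x≢r = cong length (filter-reject (λ x → x ≡? r [mod m ]) x≢r)

  ∈⇒count>0 : ∀ {x xs r} → x ∈ xs → x ≡ r [mod m ] → 0 < count xs r
  ∈⇒count>0 {r = r} x∈xs x≡r = filter-some (λ x → x ≡? r [mod m ]) (lose x∈xs x≡r)

  count>0⇒∈ : ∀ {xs r} → 0 < count xs r → ∃[ x ] (x ∈ xs × x ≡ r [mod m ])
  count>0⇒∈ {xs} {r} 0<count = witness (filter (λ x → x ≡? r [mod m ]) xs) refl 0<count
    where
    witness : ∀ ys → ys ≡ filter (λ x → x ≡? r [mod m ]) xs → 0 < length ys →
      ∃[ x ] (x ∈ xs × x ≡ r [mod m ])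
    witness (y ∷ _) eq _ =
      y , ∈-filter⁻ (λ x → x ≡? r [mod m ]) (subst (y ∈_) eq (here refl))

  -- List and class may change together, which covers translation, dilation and change of
  -- representative alike.
  count-pointwise : ∀ {xs ys r s} →
    Pointwise (λ x y → x ≡ r [mod m ] ⇔ y ≡ s [mod m ]) xs ys → count xs r ≡ count ys s
  count-pointwise {r = r} {s} xs∼ys = Pointwise-length
    (Pointwise.filter⁺ (λ x → x ≡? r [mod m ]) (λ y → y ≡? s [mod m ]) to from xs∼ys)

  count-resp-mod : ∀ xs {r s} → r ≡ s [mod m ] → count xs r ≡ count xs s
  count-resp-mod xs {r} {s} r≡s = count-pointwise
    (Pointwise.refl (mk⇔ (λ x≡r → trans x≡r r≡s) (λ x≡s → trans x≡s (sym r≡s))) {xs})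

  count-map-+ : ∀ k xs r → count (map (k +_) xs) (k + r) ≡ count xs r
  count-map-+ k [] r = refl
  count-map-+ k (x ∷ xs) r = begin
    count (map (k +_) (x ∷ xs)) (k + r)
      ≡⟨ count-++ [ k + x ] (map (k +_) xs) (k + r) ⟩
    count [ k + x ] (k + r) + count (map (k +_) xs) (k + r)
      ≡⟨ cong₂ _+_ (count-pointwise (mk⇔ (+-cancelˡ-mod k) (+-congˡ-mod k) ∷ []))
                   (count-map-+ k xs r) ⟩
    count [ x ] r + count xs r
      ≡⟨ count-++ [ x ] xs r ⟨
    count (x ∷ xs) r ∎
    where open ≡-Reasoning

  -- Residue counts along progressions and intervals.

  count-applyUpTo : ∀ f g {r s} → (∀ i → f i ≡ r [mod m ] ⇔ g i ≡ s [mod m ]) →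
    ∀ n → count (applyUpTo f n) r ≡ count (applyUpTo g n) s
  count-applyUpTo f g {r} {s} f⇔g n = count-pointwise (pointwise f g f⇔g n)
    where
    pointwise : ∀ f g → (∀ i → f i ≡ r [mod m ] ⇔ g i ≡ s [mod m ]) → ∀ n →
      Pointwise (λ x y → x ≡ r [mod m ] ⇔ y ≡ s [mod m ]) (applyUpTo f n) (applyUpTo g n)
    pointwise f g f⇔g zero = []
    pointwise f g f⇔g (suc n) = f⇔g 0 ∷ pointwise (f ∘ suc) (g ∘ suc) (f⇔g ∘ suc) n

  -- Counts `f 0`, ..., `f n` twice, splitting off the last term or the first; the terms after the
  -- first are the earlier ones translated by `k`.
  count-progression-shift : ∀ f k → (∀ i → f (suc i) ≡ k + f i) → ∀ n r →
    count (applyUpTo f n) (k + r) + count [ f n ] (k + r) ≡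
    count [ f 0 ] (k + r) + count (applyUpTo f n) r
  count-progression-shift f k f-suc n r = begin
    count (applyUpTo f n) (k + r) + count [ f n ] (k + r)
      ≡⟨ count-++ (applyUpTo f n) [ f n ] (k + r) ⟨
    count (applyUpTo f n ∷ʳ f n) (k + r)
      ≡⟨ cong (λ xs → count xs (k + r)) (applyUpTo-∷ʳ f n) ⟩
    count (applyUpTo f (suc n)) (k + r)
      ≡⟨ count-++ [ f 0 ] (applyUpTo (f ∘ suc) n) (k + r) ⟩
    count [ f 0 ] (k + r) + count (applyUpTo (f ∘ suc) n) (k + r)
      ≡⟨ cong (count [ f 0 ] (k + r) +_) (count-applyUpTo (f ∘ suc) f f∘suc⇔f n) ⟩
    count [ f 0 ] (k + r) + count (applyUpTo f n) r ∎
    where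
    open ≡-Reasoning

    f∘suc⇔f : ∀ i → f (suc i) ≡ k + r [mod m ] ⇔ f i ≡ r [mod m ]
    f∘suc⇔f i rewrite f-suc i = mk⇔ (+-cancelˡ-mod k) (+-congˡ-mod k)

  -- The progression with `k = 1`: its first term 0 is outside the class of `suc r`, so from `r` to
  -- `suc r` the count drops, by one, exactly when `b` lies in the class of `suc r`.
  upTo-step : ∀ b {r} → suc r < m →
    count (upTo b) (suc r) + count [ b ] (suc r) ≡ count (upTo b) r
  upTo-step b {r} r+1<m = trans (count-progression-shift id 1 (λ _ → refl) b r)
    (cong (_+ count (upTo b) r) (count-[≢] 0≢r+1))
    where
    0≢r+1 : ¬ 0 ≡ suc r [mod m ]
    0≢r+1 eq = 0≢1+n (trans (sym (m<n⇒m%n≡m (<-trans z<s r+1<m)))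
      (trans eq (m<n⇒m%n≡m r+1<m)))

  -- None of the classes 1 to `r` contains `b`, so no drop occurs on the way.
  upTo-low : ∀ b {r} → r < b % m → count (upTo b) r ≡ count (upTo b) 0
  upTo-low b {zero} _ = refl
  upTo-low b {suc r} r+1<b′ = begin
    count (upTo b) (suc r)                         ≡⟨ +-identityʳ _ ⟨
    count (upTo b) (suc r) + 0                     ≡⟨ cong (count (upTo b) (suc r) +_) (count-[≢] b≢r+1) ⟨
    count (upTo b) (suc r) + count [ b ] (suc r)   ≡⟨ upTo-step b r+1<m ⟩
    count (upTo b) r                               ≡⟨ upTo-low b (<-trans (n<1+n r) r+1<b′) ⟩
    count (upTo b) 0                               ∎
    where
    open ≡-Reasoning

    r+1<m : suc r < m
    r+1<m = <-trans r+1<b′ (m%n<n b m)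

    b≢r+1 : ¬ b ≡ suc r [mod m ]
    b≢r+1 eq = <⇒≢ r+1<b′ (sym (trans eq (m<n⇒m%n≡m r+1<m)))

  -- The step into the class `b % m` drops the count by one, and no later step raises it again.
  upTo-high : ∀ b {r} → 0 < b % m → b % m ≤ r → r < m → count (upTo b) r < count (upTo b) 0
  upTo-high b {zero} 0<b′ b′≤0 _ = contradiction b′≤0 (<⇒≱ 0<b′)
  upTo-high b {suc r} 0<b′ b′≤r+1 r+1<m with m≤n⇒m<n∨m≡n b′≤r+1
  ... | inj₁ b′≤r = begin-strict
    count (upTo b) (suc r)                         ≤⟨ m≤m+n _ _ ⟩
    count (upTo b) (suc r) + count [ b ] (suc r)   ≡⟨ upTo-step b r+1<m ⟩
    count (upTo b) r                               <⟨ upTo-high b 0<b′ (s≤s⁻¹ b′≤r) (<-trans (n<1+n r) r+1<m) ⟩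
    count (upTo b) 0                               ∎
    where open ≤-Reasoning
  ... | inj₂ b′≡r+1 = begin-strict
    count (upTo b) (suc r)                         <⟨ m<m+n _ z<s ⟩
    count (upTo b) (suc r) + 1                     ≡⟨ cong (count (upTo b) (suc r) +_) (count-[≡] b≡r+1) ⟨
    count (upTo b) (suc r) + count [ b ] (suc r)   ≡⟨ upTo-step b r+1<m ⟩
    count (upTo b) r                               ≡⟨ upTo-low b (≤-reflexive (sym b′≡r+1)) ⟩
    count (upTo b) 0                               ∎
    where
    open ≤-Reasoning

    b≡r+1 : b ≡ suc r [mod m ]
    b≡r+1 = trans b′≡r+1 (sym (m<n⇒m%n≡m r+1<m))

  -- Dilated intervals with the residues of the interval.

  dilated-interval⇒unit : ∀ {a b} → 1 < b →
    (∀ r → count (applyUpTo (a *_) b) r ≡ count (upTo b) r) → Coprime a m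
  dilated-interval⇒unit {a} {b} 1<b same {d} (d∣a , d∣m)
    -- As `1 < b`, the interval meets the class of 1; hence so does some multiple `a * i`.
    with x , x∈ , x≡1 ← count>0⇒∈ {applyUpTo (a *_) b} {1}
           (subst (0 <_) (sym (same 1)) (∈⇒count>0 (∈-upTo⁺ 1<b) refl))
    with i , _ , x≡ai ← ∈-applyUpTo⁻ (a *_) x∈ =
    ∣1⇒≡1 (d∣1 x (subst (d ∣_) (sym x≡ai) (∣m⇒∣m*n i d∣a)) (∣-trans d∣m (≡mod⇒∣ x≡1)))
    where
    d∣1 : ∀ x → d ∣ x → d ∣ ∣ x - 1 ∣ → d ∣ 1
    -- Here the distance to 1 is 1 itself.
    d∣1 zero _ d∣1 = d∣1
    d∣1 (suc n) d∣n+1 d∣n = ∣m+n∣m⇒∣n (subst (d ∣_) (+-comm 1 n) d∣n+1)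
      (subst (d ∣_) (∣-∣-identityʳ n) d∣n)

  module _ {a b : ℕ} (a⊥m : Coprime m a) (b⊥m : Coprime m b)
           (same : ∀ r → count (applyUpTo (a *_) b) r ≡ count (upTo b) r) where

    -- It suffices that `a * b ≡ b`, since `b` can be cancelled; `a + r` is the intermediate
    -- representative.
    dilated-interval⇒a≡1 : 1 < b % m → a ≡ 1 [mod m ]
    dilated-interval⇒a≡1 1<b′ = *-cancelˡ-mod b⊥m (begin
      (b * a) % m   ≡⟨ cong (_% m) (*-comm b a) ⟩
      (a * b) % m   ≡⟨ ab≡a+r ⟩
      (a + r) % m   ≡⟨ a+r≡b ⟩
      b % m         ≡⟨ cong (_% m) (*-identityʳ b) ⟨
      (b * 1) % m   ∎)
      where
      open ≡-Reasoning
      a′ = a % m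
      b′ = b % m
      -- The class that translation by `a` carries to that of `b`; `0 < a′ < b′`, shown below, gives
      -- `r < b′`.
      r = b′ ∸ a′

      0<b′ : 0 < b′
      0<b′ = <-trans z<s 1<b′

      -- As `a` is a unit, `a * i ≡ a` exactly when `i ≡ 1`, and `1 < b′` gives the class of 1 the
      -- maximal count.
      count-a′ : count (upTo b) a′ ≡ count (upTo b) 0
      count-a′ = begin
        count (upTo b) a′             ≡⟨ count-resp-mod (upTo b) (%-mod a) ⟩
        count (upTo b) a              ≡⟨ same a ⟨
        count (applyUpTo (a *_) b) a  ≡⟨ count-applyUpTo (a *_) id ai≡a⇔i≡1 b ⟩
        count (upTo b) 1              ≡⟨ upTo-low b 1<b′ ⟩
        count (upTo b) 0              ∎
        where
        ai≡a⇔i≡1 : ∀ i → a * i ≡ a [mod m ] ⇔ i ≡ 1 [mod m ]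
        ai≡a⇔i≡1 i = subst (λ c → a * i ≡ c [mod m ] ⇔ i ≡ 1 [mod m ]) (*-identityʳ a)
          (mk⇔ (*-cancelˡ-mod a⊥m) (*-congˡ-mod a))

      a′<b′ : a′ < b′
      a′<b′ = ≰⇒> λ b′≤a′ → <⇒≢ (upTo-high b 0<b′ b′≤a′ (m%n<n a m)) count-a′

      -- A zero residue would make `m` divide `a`, hence `m ≡ 1` by coprimality, against
      -- `1 < b′ < m`.
      0<a′ : 0 < a′
      0<a′ = n≢0⇒n>0 λ a′≡0 → <⇒≢ (<-trans 1<b′ (m%n<n b m))
        (sym (a⊥m (∣-refl , m%n≡0⇒n∣m a m a′≡0)))

      a+r≡b : a + r ≡ b [mod m ]
      a+r≡b = begin
        (a + r) % m    ≡⟨ cong (_% m) (+-comm a r) ⟩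
        (r + a) % m    ≡⟨ +-congˡ-mod r (%-mod a) ⟨
        (r + a′) % m   ≡⟨ cong (_% m) (m∸n+n≡m (<⇒≤ a′<b′)) ⟩
        b′ % m         ≡⟨ %-mod b ⟩
        b % m          ∎

      Ap = applyUpTo (a *_) b

      -- In the interval, `a + r` falls in the class `b′`, just past the drop, and `r` lies before
      -- it.
      count-increases : count Ap (a + r) < count Ap r
      count-increases = subst₂ _<_
        (begin
          count (upTo b) b′        ≡⟨ count-resp-mod (upTo b) (trans (%-mod b) (sym a+r≡b)) ⟩
          count (upTo b) (a + r)   ≡⟨ same (a + r) ⟨
          count Ap (a + r)         ∎)
        (begin
          count (upTo b) 0   ≡⟨ upTo-low b (∸-monoʳ-< 0<a′ (<⇒≤ a′<b′)) ⟨
          count (upTo b) r   ≡⟨ same r ⟨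
          count Ap r         ∎)
        (upTo-high b 0<b′ ≤-refl (m%n<n b m))

      -- The progression identity leaves only the extra term `a * b` to make up for the smaller
      -- count at `a + r`, so that term lies in this class.
      ab≡a+r : a * b ≡ a + r [mod m ]
      ab≡a+r with x , here refl , eq ← count>0⇒∈ {[ a * b ]} {a + r}
        (+-cancelˡ-< (count Ap (a + r)) 0 _ (subst₂ _<_ (sym (+-identityʳ _))
          (sym (count-progression-shift (a *_) a (*-suc a) b r))
          (<-≤-trans count-increases (m≤n+m _ _)))) = eq

    dilated-interval : a ≡ 1 [mod m ] ⊎ b ≡ 1 [mod m ]
    dilated-interval with <-cmp (b % m) 1
    ... | tri> _ _ 1<b′ = inj₁ (dilated-interval⇒a≡1 1<b′)
    -- As a remainder, 1 is below `m`, so `1 % m` is 1.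
    ... | tri≈ _ b′≡1 _ = inj₂ (trans b′≡1 (sym (m<n⇒m%n≡m (subst (_< m) b′≡1 (m%n<n b m)))))
    -- Now `m` divides `b` and is coprime to it, so `m` is 1 and every congruence holds.
    ... | tri< b′<1 _ _ = inj₁ (∣⇒≡mod (subst (_∣ ∣ a - 1 ∣) (sym m≡1) (1∣ _)))
      where
      m≡1 : m ≡ 1
      m≡1 = b⊥m (∣-refl , m%n≡0⇒n∣m b m (n<1⇒n≡0 b′<1))

  -- Residue counts of the gaps.

  module _ (S : NumericalSemigroup) {a b : ℕ} (1<a : 1 < a) (1<b : 1 < b)
           (a⊥b : Coprime a b) (S≐ : Carrier S ≐ ⟨ a ∷ b ∷ [] ⟩) where

    private
      Ap = applyUpTo (a *_) b

    count-gaps-shift : ∀ r →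
      count (H S) (b + r) + count Ap (b + r) ≡ count (H S) r + count (upTo b) (b + r)
    count-gaps-shift r = begin
      count (H S) (b + r) + count Ap (b + r)
        ≡⟨ count-++ (H S) Ap (b + r) ⟨
      count (H S ++ Ap) (b + r)
        ≡⟨ count-↭ (gaps++Apéry↭ S 1<a 1<b a⊥b S≐) (b + r) ⟩
      count (map (b +_) (H S) ++ upTo b) (b + r)
        ≡⟨ count-++ (map (b +_) (H S)) (upTo b) (b + r) ⟩
      count (map (b +_) (H S)) (b + r) + count (upTo b) (b + r)
        ≡⟨ cong (_+ count (upTo b) (b + r)) (count-map-+ b (H S) r) ⟩
      count (H S) r + count (upTo b) (b + r) ∎
      where open ≡-Reasoning

    -- Equidistribution cancels the two gap counts in `count-gaps-shift`; it applies directly since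
    -- `count` unfolds to the same term as `classSize`.
    equidistributed⇒dilated-interval : EquidistributedModulo m (H S) →
      ∀ r → count Ap r ≡ count (upTo b) r
    equidistributed⇒dilated-interval equi r = begin
      count Ap r              ≡⟨ count-resp-mod Ap b+r′≡r ⟨
      count Ap (b + r′)       ≡⟨ +-cancelˡ-≡ (count (H S) r′) _ _
                                  (trans (cong (_+ count Ap (b + r′)) (equi r′ (b + r′)))
                                         (count-gaps-shift r′)) ⟩
      count (upTo b) (b + r′) ≡⟨ count-resp-mod (upTo b) b+r′≡r ⟩
      count (upTo b) r        ∎
      where
      open ≡-Reasoning
      -- Represents `r` minus `b` modulo `m` without subtraction: adding `b` gives `r + b * m`.
      r′ = r + pred m * b

      b+r′≡r : b + r′ ≡ r [mod m ]
      b+r′≡r = begin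
        (b + (r + pred m * b)) % m   ≡⟨ cong (_% m) (lemma b r (pred m)) ⟩
        (r + b * suc (pred m)) % m   ≡⟨ cong (λ n → (r + b * n) % m) (suc-pred m) ⟩
        (r + b * m) % m              ≡⟨ [m+kn]%n≡m%n r b m ⟩
        r % m                        ∎
        where
        lemma : ∀ b r n → b + (r + n * b) ≡ r + b * suc n
        lemma = solve-∀

    -- Modulo `m` the Apéry set and the interval agree term by term, so their counts cancel and `b`
    -- becomes a period of the gap count, next to `m`.
    a≡1⇒equidistributed : Coprime b m → a ≡ 1 [mod m ] → EquidistributedModulo m (H S)
    a≡1⇒equidistributed b⊥m a≡1 = coprime-periods⇒constant b⊥m period-b
      (λ r → count-resp-mod (H S) (trans (cong (_% m) (+-comm m r)) ([m+n]%n≡m%n r m)))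
      where
      ai≡i : ∀ i → a * i ≡ i [mod m ]
      ai≡i i = trans (cong (_% m) (*-comm a i))
        (trans (*-congˡ-mod i a≡1) (cong (_% m) (*-identityʳ i)))

      period-b : ∀ r → count (H S) (b + r) ≡ count (H S) r
      period-b r = +-cancelʳ-≡ (count (upTo b) (b + r)) _ _ (trans
        (cong (count (H S) (b + r) +_) (count-applyUpTo id (a *_)
          (λ i → mk⇔ (trans (ai≡i i)) (trans (sym (ai≡i i)))) b))
        (count-gaps-shift r))

-- The equivalence.

coprime-*ˡ : ∀ {a b m} → Coprime a m → Coprime b m → Coprime (a * b) m
coprime-*ˡ a⊥m b⊥m {d} (d∣ab , d∣m) = b⊥m (coprime-divisor d⊥a d∣ab , d∣m)
  where
  -- A common divisor of `d` and `a` also divides `m`.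
  d⊥a : Coprime d _
  d⊥a (e∣d , e∣a) = a⊥m (e∣a , ∣-trans e∣d d∣m)

corollary5p8 : (S : NumericalSemigroup) → HasEmbeddingDimension S 2 →
    (∃[ a ] ∃[ b ] (1 < a × 1 < b × gcd a b ≡ 1 × Carrier S ≐ ⟨ a ∷ b ∷ [] ⟩)) ×
    ((a b : ℕ) → 1 < a → 1 < b → gcd a b ≡ 1 → Carrier S ≐ ⟨ a ∷ b ∷ [] ⟩ →
    (m : ℕ) .{{_ : NonZero m}} →
    EquidistributedModulo m (H S) ⇔
    (gcd (a * b) m ≡ 1 × (a ≡ 1 [mod m ] ⊎ b ≡ 1 [mod m ])))
corollary5p8 S e≡2 = coprime-generators S e≡2 , λ a b 1<a 1<b gcd≡1 S≐ m →
  let a⊥b = gcd≡1⇒coprime gcd≡1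
      b⊥a = Coprime.sym a⊥b
      S≐′ = ≐⟨⟩-swap S S≐
  in mk⇔
    (λ equi →
      let same = equidistributed⇒dilated-interval S 1<a 1<b a⊥b S≐ equi
          a⊥m = dilated-interval⇒unit 1<b same
          -- The same argument with the generators exchanged: the interval of length `a`, dilated by
          -- `b`.
          b⊥m = dilated-interval⇒unit 1<a
                  (equidistributed⇒dilated-interval S 1<b 1<a b⊥a S≐′ equi)
      in coprime⇒gcd≡1 (coprime-*ˡ a⊥m b⊥m) ,
         dilated-interval (Coprime.sym a⊥m) (Coprime.sym b⊥m) same)
    (λ (gcd-ab-m≡1 , a≡1⊎b≡1) →
      let ab⊥m = gcd≡1⇒coprime gcd-ab-m≡1
      in Sum.[ a≡1⇒equidistributed S 1<a 1<b a⊥b S≐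
                 (λ (d∣b , d∣m) → ab⊥m (∣n⇒∣m*n a d∣b , d∣m))
             , a≡1⇒equidistributed S 1<b 1<a b⊥a S≐′
                 (λ (d∣a , d∣m) → ab⊥m (∣m⇒∣m*n b d∣a , d∣m))
             ] a≡1⊎b≡1)
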